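{- Let $k\ge2$ be an integer. There exists an absolute constant $c>0$, independent of $k$, such that for all sufficiently large primes $p$ (depending on $k$) and all integers $s$ with $0\le s<c\lfloor p^{1/k}\rfloor$, there exists a set $A$ of $k$ non-zero elements of $\mathbb{Z}_p$ such that $A\cup\{0\}$ is a basis for $\mathbb{Z}_p$ of order $k\lfloor p^{1/k}\rfloor+s$.
   Context: $\mathbb{Z}_p=\mathbb{Z}/p\mathbb{Z}$. For $B\subseteq\mathbb{Z}_p$ and a positive integer $h$, $hB$ is the set of all sums of exactly $h$ (not necessarily distinct) elements of $B$. $B$ is a basis for $\mathbb{Z}_p$ of order $h$ if $hB=\mathbb{Z}_p$ and $(h-1)B\neq\mathbb{Z}_p$. -}

module Defs where

open import Data.Nat using (ℕ; zero; suc; _+_; _*_; _∸_; _^_; _≤_; _<_)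
open import Data.Nat.Primality using (Prime)
open import Data.Product using (Σ; _×_; ∃)
open import Data.Sum using (_⊎_)
open import Data.Vec using (Vec; sum; toList)
open import Data.Vec.Membership.Propositional using (_∈_)
open import Data.Vec.Relation.Unary.All using (All)
open import Data.List.Relation.Unary.Unique.Propositional using (Unique)
open import Relation.Binary.PropositionalEquality using (_≡_)
open import Relation.Nullary using (¬_)

-- Elements of ℤ_p are represented by their canonical residues x ∈ {0,…,p-1} (natural numbers x < p).
-- A subset B of ℤ_p is a predicate on ℕ (only its values on residues < p matter).

-- x ∈ hB (for a residue x < p) : x is congruent mod p to a sum of exactly h (not necessarily distinct) elements of B.
InSumset : (p : ℕ) → (ℕ → Set) → (h : ℕ) → ℕ → Set
InSumset p B h x = Σ (Vec ℕ h) λ v → All B v × Σ ℕ λ q → sum v ≡ x + q * p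

Covers : (p : ℕ) → (ℕ → Set) → (h : ℕ) → Set
Covers p B h = (x : ℕ) → x < p → InSumset p B h x

IsBasisOfOrder : (p : ℕ) → (ℕ → Set) → (h : ℕ) → Set
IsBasisOfOrder p B h = Covers p B h × ¬ Covers p B (h ∸ 1)

WithZero : {k : ℕ} → Vec ℕ k → ℕ → Set
WithZero A y = (y ≡ 0) ⊎ (y ∈ A)

IsFloorRoot : (k p m : ℕ) → Set
IsFloorRoot k p m = (m ^ k ≤ p) × (p < suc m ^ k)

NonzeroSet : (p k : ℕ) → Vec ℕ k → Set
NonzeroSet p k A = All (λ a → (0 < a) × (a < p)) A × Unique (toList A)

{-# OPTIONS --safe #-}
module Submission where

open import Defs
open import Data.Empty using (⊥-elim)
open import Data.List using () renaming (_∷_ to _⨾_; [] to ⟨⟩)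
open import Data.List.Relation.Unary.All as ListAll using ()
open import Data.List.Relation.Unary.AllPairs as AllPairs using ()
open import Data.Nat
open import Data.Nat.DivMod
open import Data.Nat.Primality using (Prime)
open import Data.Nat.Properties
open import Data.Nat.Tactic.RingSolver using (solve; solve-∀)
open import Data.Product using (Σ; ∃; _×_; _,_; proj₁; proj₂; map₂)
open import Data.Sum using (inj₁; inj₂)
open import Data.Vec using (Vec; []; _∷_; sum; toList)
open import Data.Vec.Membership.Propositional using (_∈_)
open import Data.Vec.Relation.Unary.All as All using (All; []; _∷_)
open import Data.Vec.Relation.Unary.All.Properties using (toList⁺)
open import Data.Vec.Relation.Unary.Any using (here; there)
open import Relation.Binary.PropositionalEquality
open import Relation.Nullary using (¬_)

-- With m = ⌊p^(1/k)⌋ define a_{k+1} = p and, downwards, a_i = ⌊(a_{i+1} + 2m + 1)/(m + 1)⌋, so that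
-- (m + 1) a_i exceeds a_{i+1} by an amount δ_i with m < δ_i ≤ 2m + 1. Put N = a_3 = gD + t with t < g
-- and A = {1, g, a_3, …, a_k}. Greedy expansion writes every residue with at most
-- (g − 1) + (D − 1) + (m − 1) + m + ⋯ + m elements: since δ_3 > t, the digit m of a_3 never meets the
-- full lower digits (g − 1, D − 1). No representation of the number with exactly these digits, nor of
-- a number congruent to it, is shorter: trading a_{i+1} for m + 1 copies of a_i adds m elements and
-- lowers the part made from 1 and g by δ_i ≤ 3g, so S such trades add mS elements and save at most
-- g − 2 + 3S ≤ mS, while the opposite trades are impossible because the lower digits amount to less
-- than a_{i+1}. So the order is an explicit function of g + ⌊N/g⌋, and N ≈ m² lets g range over an
-- interval below m on which that sum takes every value from 2m + 2 to (2 + 1/50)m.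

-- Farkas-style certificate: the hypothesis l ≤ r proves L ≤ R up to a ring identity.
≤-certificate : ∀ {l r} L R k → l ≤ r → L + r + k ≡ R + l → L ≤ R
≤-certificate {l} {r} L R k l≤r eq = +-cancelʳ-≤ r L R (begin
  L + r      ≤⟨ m≤m+n (L + r) k ⟩
  L + r + k  ≡⟨ eq ⟩
  R + l      ≤⟨ +-monoʳ-≤ R l≤r ⟩
  R + r      ∎)
  where open ≤-Reasoning

infixl 4 _⊕_
_⊕_ : ∀ {a b c d} → a ≤ b → c ≤ d → a + c ≤ b + d
_⊕_ = +-mono-≤

infixr 5 _⊙_
_⊙_ : ∀ {a b} c → a ≤ b → c * a ≤ c * b
c ⊙ a≤b = *-monoʳ-≤ c a≤b

*-swap : ∀ a b c → a * (b * c) ≡ b * (a * c)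
*-swap = solve-∀

-- Sums of at most w elements

-- Each coefficient `c` is charged against the budget `w`. What is left of `w` at `[]` is free: it
-- stands for the summands equal to 0.
Rep : ∀ {k} → Vec ℕ k → ℕ → ℕ → Set
Rep []      w x = x ≡ 0
Rep (a ∷ A) w x = Σ ℕ λ c → Σ ℕ λ w′ → Σ ℕ λ r → w ≡ c + w′ × x ≡ c * a + r × Rep A w′ r

rep-≤ : ∀ {k} (A : Vec ℕ k) {w w′ x} → w ≤ w′ → Rep A w x → Rep A w′ x
rep-≤ []      w≤w′ rep = rep
rep-≤ (a ∷ A) w≤w′ (c , w₁ , r , refl , x≡ , rep) with m≤n⇒∃[o]m+o≡n w≤w′
... | d , refl = c , w₁ + d , r , +-assoc c w₁ d , x≡ , rep-≤ A (m≤m+n w₁ d) rep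

rep-zero : ∀ {k} (A : Vec ℕ k) → Rep A 0 0
rep-zero []      = refl
rep-zero (a ∷ A) = 0 , 0 , 0 , refl , refl , rep-zero A

rep-generator : ∀ {k} (A : Vec ℕ k) {a w x} → a ∈ A → Rep A w x → Rep A (suc w) (a + x)
rep-generator (a ∷ A) (here refl) (c , w′ , r , refl , refl , rep) =
  suc c , w′ , r , refl , sym (+-assoc a (c * a) r) , rep
rep-generator (b ∷ A) {a} (there a∈A) (c , w′ , r , refl , refl , rep) =
  c , suc w′ , a + r , sym (+-suc c w′) , swap a (c * b) r , rep-generator A a∈A rep
  where
  swap : ∀ a b r → a + (b + r) ≡ b + (a + r)
  swap = solve-∀

sum⇒rep : ∀ {k} (A : Vec ℕ k) {h} (v : Vec ℕ h) → All (WithZero A) v → Rep A h (sum v)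
sum⇒rep A []      []              = rep-zero A
sum⇒rep A (_ ∷ v) (inj₁ refl ∷ ps) = rep-≤ A (n≤1+n _) (sum⇒rep A v ps)
sum⇒rep A (_ ∷ v) (inj₂ a∈A ∷ ps)  = rep-generator A a∈A (sum⇒rep A v ps)

SumOf : ∀ {k} → Vec ℕ k → ℕ → ℕ → Set
SumOf A h x = Σ (Vec ℕ h) λ v → All (WithZero A) v × sum v ≡ x

sumOf-zero : ∀ {k} (A : Vec ℕ k) h → SumOf A h 0
sumOf-zero A zero    = [] , [] , refl
sumOf-zero A (suc h) with sumOf-zero A h
... | v , ps , eq = 0 ∷ v , inj₁ refl ∷ ps , eq

sumOf-multiple : ∀ {k} (A : Vec ℕ k) {a h x} c → a ∈ A → SumOf A h x → SumOf A (c + h) (c * a + x)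
sumOf-multiple A zero    a∈A s = s
sumOf-multiple A {a} {h} {x} (suc c) a∈A s with sumOf-multiple A c a∈A s
... | v , ps , eq = a ∷ v , inj₂ a∈A ∷ ps , trans (cong (a +_) eq) (sym (+-assoc a (c * a) x))

sumOf-tail : ∀ {k} a (A : Vec ℕ k) {h x} → SumOf A h x → SumOf (a ∷ A) h x
sumOf-tail a A = map₂ λ (ps , eq) → All.map (λ { (inj₁ z) → inj₁ z ; (inj₂ b∈A) → inj₂ (there b∈A) }) ps , eq

rep⇒sum : ∀ {k} (A : Vec ℕ k) {h x} → Rep A h x → SumOf A h x
rep⇒sum []      {h} refl = sumOf-zero [] h
rep⇒sum (a ∷ A) (c , w′ , r , refl , refl , rep) =
  sumOf-multiple (a ∷ A) c (here refl) (sumOf-tail a A (rep⇒sum A rep))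

-- The generators

shrink : ℕ → ℕ → ℕ
shrink m q = (q + (1 + 2 * m)) / suc m

-- `suc m * shrink m q` is the least multiple of `suc m` above `q + m`. If `r` is the remainder of
-- the division, then `z` is m - r and δ = (m + 1) + (m - r).
shrink-spec : ∀ m q → ∃ λ δ → m < δ × δ ≤ 1 + 2 * m × q + δ ≡ suc m * shrink m q
shrink-spec m q with m≤n⇒∃[o]m+o≡n (≤-pred (m%n<n (q + (1 + 2 * m)) (suc m)))
... | z , r+z≡m = suc (m + z) , s≤s (m≤m+n m z) , δ≤ _ z r+z≡m , eq _ _ z r+z≡m (m≡m%n+[m/n]*n (q + (1 + 2 * m)) (suc m))
  where
  δ≤ : ∀ r z → r + z ≡ m → suc (m + z) ≤ 1 + 2 * m
  δ≤ r z h = ≤-certificate (suc (m + z)) (1 + 2 * m) r (≤-reflexive h) (solve (m ⨾ r ⨾ z ⨾ ⟨⟩))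
  eq : ∀ r d z → r + z ≡ m → q + (1 + 2 * m) ≡ r + d * suc m → q + suc (m + z) ≡ suc m * d
  eq r d z h h′ = +-cancelʳ-≡ r (q + suc (m + z)) (suc m * d) (begin
    q + suc (m + z) + r    ≡⟨ solve (q ⨾ m ⨾ r ⨾ z ⨾ ⟨⟩) ⟩
    q + (1 + m + (r + z))  ≡⟨ cong (λ y → q + (1 + m + y)) h ⟩
    q + (1 + m + m)        ≡⟨ solve (q ⨾ m ⨾ ⟨⟩) ⟩
    q + (1 + 2 * m)        ≡⟨ h′ ⟩
    r + d * suc m          ≡⟨ solve (m ⨾ r ⨾ d ⨾ ⟨⟩) ⟩
    suc m * d + r          ∎)
    where open ≡-Reasoning

gens : (m g j q : ℕ) → Vec ℕ (2 + j)
gens m g zero    q = g ∷ 1 ∷ []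
gens m g (suc j) q = shrink m q ∷ gens m g j (shrink m q)

bottom : (m j q : ℕ) → ℕ
bottom m zero    q = q
bottom m (suc j) q = bottom m j (shrink m q)

-- digit m 0 is the digit of a_3, the only one whose value m never occurs on top of full lower digits.
digit : (m j : ℕ) → ℕ
digit m zero    = pred m
digit m (suc _) = m

weight : (m w₀ j : ℕ) → ℕ
weight m w₀ zero    = w₀
weight m w₀ (suc j) = digit m j + weight m w₀ j

-- Later `c₀` is gD - 1 = (D - 1)g + (g - 1), so that all digits are full.
corner : (m c₀ j q : ℕ) → ℕ
corner m c₀ zero    q = c₀
corner m c₀ (suc j) q = digit m j * shrink m q + corner m c₀ j (shrink m q)

-- Distinctness

module _ {m : ℕ} (2≤m : 2 ≤ m) where

  -- `m * shrink m q` is at least 3m, which beats the rounding 2m + 1 once m ≥ 2.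
  shrink< : ∀ q → 3 ≤ shrink m q → shrink m q < q
  shrink< q 3≤q′ with shrink-spec m q
  ... | δ , _ , δ≤ , eq = certificate δ (shrink m q) δ≤ (≤-reflexive (sym eq)) 3≤q′
    where
    certificate : ∀ δ q′ → δ ≤ 1 + 2 * m → suc m * q′ ≤ q + δ → 3 ≤ q′ → q′ < q
    certificate δ q′ δ≤ h 3≤q′ =
      ≤-certificate (suc q′) q 0 (h ⊕ δ≤ ⊕ m ⊙ 3≤q′ ⊕ 2≤m) (solve (m ⨾ δ ⨾ q ⨾ q′ ⨾ ⟨⟩))

  bottom≤ : ∀ j q → 3 ≤ bottom m j q → bottom m j q ≤ q
  bottom≤ zero    q _   = ≤-refl
  bottom≤ (suc j) q 3≤N = ≤-trans N≤q′ (<⇒≤ (shrink< q (≤-trans 3≤N N≤q′)))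
    where
    N≤q′ : bottom m j (shrink m q) ≤ shrink m q
    N≤q′ = bottom≤ j (shrink m q) 3≤N

  gens-nonzeroSet : ∀ {g} j q → 1 < g → g < bottom m j q → 3 ≤ bottom m j q → NonzeroSet q (2 + j) (gens m g j q)
  gens-nonzeroSet zero q 1<g g<q _ =
    (<-trans z<s 1<g , g<q) ∷ (z<s , <-trans 1<g g<q) ∷ [] ,
    ((λ { refl → <-irrefl refl 1<g }) ListAll.∷ ListAll.[]) AllPairs.∷ ListAll.[] AllPairs.∷ AllPairs.[]
  gens-nonzeroSet {g} (suc j) q 1<g g<N 3≤N with gens-nonzeroSet j (shrink m q) 1<g g<N 3≤N
  ... | below , unique =
    (<-trans z<s 3≤q′ , q′<q) ∷ All.map (map₂ (λ a<q′ → <-trans a<q′ q′<q)) below ,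
    ListAll.map (λ { (_ , a<q′) refl → <-irrefl refl a<q′ }) (toList⁺ below) AllPairs.∷ unique
    where
    3≤q′ : 3 ≤ shrink m q
    3≤q′ = ≤-trans 3≤N (bottom≤ j (shrink m q) 3≤N)
    q′<q : shrink m q < q
    q′<q = shrink< q 3≤q′

-- Lower bound

module _ {m c₀ : ℕ} .{{_ : NonZero m}} where

  -- A digit `m` leaves one of the m + 1 copies of q′ making up q + δ, and that copy holds the part
  -- below, so roundings cost at most 2m + 1 per level. The last digit m - 1 leaves a spare a_3,
  -- which pays for them in `corner<`.
  corner-slack : ∀ j q → c₀ < bottom m (suc j) q →
    corner m c₀ (suc j) q + bottom m (suc j) q < q + (1 + 2 * m) * suc j
  corner-slack zero q c₀<N with shrink-spec m q
  ... | δ , _ , δ≤ , eq = certificate m δ (shrink m q) δ≤ (≤-reflexive (sym eq)) c₀<N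
    where
    certificate : ∀ m .{{_ : NonZero m}} δ N → δ ≤ 1 + 2 * m → suc m * N ≤ q + δ → c₀ < N →
      pred m * N + c₀ + N < q + (1 + 2 * m) * 1
    certificate (suc μ) δ N δ≤ h c₀<N =
      ≤-certificate (suc (μ * N + c₀ + N)) (q + (1 + 2 * suc μ) * 1) 0 (δ≤ ⊕ h ⊕ c₀<N) (solve (μ ⨾ δ ⨾ N ⨾ q ⨾ c₀ ⨾ ⟨⟩))
  corner-slack (suc j) q c₀<N with shrink-spec m q
  ... | δ , _ , δ≤ , eq =
    certificate δ (shrink m q) (corner m c₀ (suc j) (shrink m q)) (bottom m (suc (suc j)) q)
      δ≤ (≤-reflexive (sym eq)) (corner-slack j (shrink m q) c₀<N)
    where
    certificate : ∀ δ q′ X N → δ ≤ 1 + 2 * m → suc m * q′ ≤ q + δ → X + N < q′ + (1 + 2 * m) * suc j →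
      m * q′ + X + N < q + (1 + 2 * m) * suc (suc j)
    certificate δ q′ X N δ≤ h X<q′ =
      ≤-certificate (suc (m * q′ + X + N)) (q + (1 + 2 * m) * suc (suc j)) 0 (δ≤ ⊕ h ⊕ X<q′)
        (solve (m ⨾ δ ⨾ N ⨾ q ⨾ q′ ⨾ X ⨾ j ⨾ ⟨⟩))

  corner< : ∀ j q → c₀ < bottom m j q → (1 + 2 * m) * j ≤ bottom m j q → corner m c₀ j q < q
  corner< zero    q c₀<N _ = c₀<N
  corner< (suc j) q c₀<N N-large =
    +-cancelʳ-< _ _ _ (<-≤-trans (corner-slack j q c₀<N) (+-monoʳ-≤ q N-large))

  module _ {g D t w₀ : ℕ} (3≤g : 3 ≤ g) (g≤D : g ≤ D) (g<m : g < m) (δ≤3g : 1 + 2 * m ≤ 3 * g)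
           (c₀≡ : suc c₀ ≡ g * D) (w₀≡ : w₀ + 2 ≡ g + D) where

    private
      1≤g : 1 ≤ g
      1≤g = ≤-trans (s≤s z≤n) 3≤g
      1≤D : 1 ≤ D
      1≤D = ≤-trans 1≤g g≤D

    -- E is the total deficit suc m * q′ ∸ q collected over the S wraps made at the levels above.
    two-coins-value : ∀ C E S y₂ y₁ → y₂ * g + y₁ + E ≡ c₀ + C * (g * D + t) → E ≤ 3 * g * S →
      D * (1 + C) ≤ y₂ + y₁ + 3 * S
    two-coins-value C E S y₂ y₁ eq E≤ = ≮⇒≥ λ lt → <⇒≱ (≤-trans (s≤s (s≤s z≤n)) 3≤g) (g≤1 _ _ lt scaled)
      where
      -- A coin is worth at most g, so g times the count bounds the value. The 1 comes from `c₀` =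
      -- gD - 1; as g ≥ 2, it cannot bridge a whole unit of the count.
      scaled : g * (D * (1 + C)) ≤ g * (y₂ + y₁ + 3 * S) + 1
      scaled = ≤-certificate (g * (D * (1 + C))) (g * (y₂ + y₁ + 3 * S) + 1) (C * t)
        (≤-reflexive (sym eq) ⊕ E≤ ⊕ ≤-reflexive (sym c₀≡) ⊕ y₁ ⊙ 1≤g)
        (solve (g ⨾ D ⨾ C ⨾ t ⨾ E ⨾ S ⨾ y₂ ⨾ y₁ ⨾ c₀ ⨾ ⟨⟩))
      g≤1 : ∀ a b → b < a → g * a ≤ g * b + 1 → g ≤ 1
      g≤1 a b b<a h = ≤-certificate g 1 0 (g ⊙ b<a ⊕ h) (solve (g ⨾ a ⨾ b ⨾ ⟨⟩))

    -- If S ≥ 1, the m of one trade covers g + 1 and that of every other covers 3. If S = 0 < C, the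
    -- additional D ≥ g coins suffice. If both vanish, the value is exactly gD - 1, and replacing
    -- coins g by ones only adds coins.
    two-coins-minimal : ∀ C E S y₂ y₁ → y₂ * g + y₁ + E ≡ c₀ + C * (g * D + t) → E ≤ 3 * g * S →
      w₀ + C ≤ y₂ + y₁ + m * S
    two-coins-minimal C E (suc S) y₂ y₁ eq E≤ =
      ≤-certificate (w₀ + C) (y₂ + y₁ + m * suc S) 0
        (two-coins-value C E (suc S) y₂ y₁ eq E≤ ⊕ ≤-reflexive w₀≡ ⊕ g<m ⊕ S ⊙ ≤-trans 3≤g (<⇒≤ g<m) ⊕ C ⊙ 1≤D)
        (solve (m ⨾ w₀ ⨾ g ⨾ D ⨾ C ⨾ S ⨾ y₂ ⨾ y₁ ⨾ ⟨⟩))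
    two-coins-minimal (suc C) E zero y₂ y₁ eq E≤ =
      ≤-certificate (w₀ + suc C) (y₂ + y₁ + m * 0) 1
        (two-coins-value (suc C) E 0 y₂ y₁ eq E≤ ⊕ ≤-reflexive w₀≡ ⊕ g≤D ⊕ C ⊙ 1≤D)
        (solve (m ⨾ w₀ ⨾ g ⨾ D ⨾ C ⨾ y₂ ⨾ y₁ ⨾ ⟨⟩))
    two-coins-minimal zero E zero y₂ y₁ eq E≤ with m≤n⇒∃[o]m+o≡n y₂<D
      where
      y₂<D : y₂ < D
      y₂<D = *-cancelʳ-< g y₂ D (≤-certificate (suc (y₂ * g)) (D * g) (y₁ + E)
        (≤-reflexive eq ⊕ ≤-reflexive c₀≡) (solve (g ⨾ D ⨾ t ⨾ E ⨾ y₂ ⨾ y₁ ⨾ c₀ ⨾ ⟨⟩)))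
    ... | z , D≡ = ≤-certificate (w₀ + 0) (y₂ + y₁ + m * 0) 0
        (≤-reflexive w₀≡ ⊕ ≤-reflexive (sym D≡) ⊕ ≤-reflexive (sym c₀≡) ⊕ g ⊙ ≤-reflexive D≡
          ⊕ ≤-reflexive (sym eq) ⊕ E≤ ⊕ z ⊙ 1≤g)
        (solve (m ⨾ w₀ ⨾ g ⨾ D ⨾ t ⨾ z ⨾ E ⨾ y₂ ⨾ y₁ ⨾ c₀ ⨾ ⟨⟩))

    -- C counts the multiples of q that wrap around at the current level; it never goes negative,
    -- because the digits below contribute less than one q.
    corner-minimal : ∀ j q C E S {w V} → bottom m j q ≡ g * D + t → (1 + 2 * m) * j ≤ bottom m j q →
      Rep (gens m g j q) w V → V + E ≡ corner m c₀ j q + C * q → E ≤ 3 * g * S →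
      weight m w₀ j + C ≤ w + m * S
    corner-minimal zero q C E S refl _ (y₂ , _ , _ , refl , refl , y₁ , w′ , _ , refl , refl , refl) eq E≤ =
      ≤-trans (two-coins-minimal C E S y₂ y₁ (trans drop-one eq) E≤)
        (+-monoˡ-≤ (m * S) (+-monoʳ-≤ y₂ (m≤m+n y₁ w′)))
      where
      drop-one : y₂ * g + y₁ + E ≡ y₂ * g + (y₁ * 1 + 0) + E
      drop-one = solve (g ⨾ E ⨾ y₂ ⨾ y₁ ⨾ ⟨⟩)
    corner-minimal (suc j) q C E S N≡ N-large (y , w′ , V′ , refl , refl , rep) eq E≤ with shrink-spec m q
    ... | δ , _ , δ≤ , q≡ = finish (m≤n⇒∃[o]m+o≡n y≤)
      where
      q′ = shrink m q
      X = corner m c₀ j q′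
      N-large′ : (1 + 2 * m) * j ≤ bottom m j q′
      N-large′ = ≤-trans ((1 + 2 * m) ⊙ n≤1+n j) N-large
      X<q′ : X < q′
      X<q′ = corner< j q′ (≤-trans (≤-reflexive c₀≡) (≤-trans (m≤m+n (g * D) t) (≤-reflexive (sym N≡)))) N-large′

      q′≤X : ∀ d q′ X → y * q′ + V′ + E ≡ d * q′ + X + C * q → q + δ ≡ suc m * q′ → d + C * suc m < y → q′ ≤ X
      q′≤X d q′ X eq q≡ lt = ≤-certificate q′ X (V′ + E + C * δ)
        (q′ ⊙ lt ⊕ ≤-reflexive eq ⊕ C ⊙ ≤-reflexive q≡)
        (solve (m ⨾ C ⨾ E ⨾ y ⨾ V′ ⨾ δ ⨾ d ⨾ q ⨾ q′ ⨾ X ⨾ ⟨⟩))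
      y≤ : y ≤ digit m j + C * suc m
      y≤ = ≮⇒≥ λ lt → <⇒≱ X<q′ (q′≤X (digit m j) q′ X eq q≡ lt)

      eq′ : ∀ d q′ X C′ → y * q′ + V′ + E ≡ d * q′ + X + C * q → q + δ ≡ suc m * q′ →
        y + C′ ≡ d + C * suc m → V′ + (E + C * δ) ≡ X + C′ * q′
      eq′ d q′ X C′ eq q≡ y≡ = +-cancelˡ-≡ (y * q′) _ _ (begin
        y * q′ + (V′ + (E + C * δ))    ≡⟨ solve (C ⨾ E ⨾ y ⨾ V′ ⨾ δ ⨾ q′ ⨾ ⟨⟩) ⟩
        y * q′ + V′ + E + C * δ        ≡⟨ cong (_+ C * δ) eq ⟩
        d * q′ + X + C * q + C * δ     ≡⟨ solve (C ⨾ d ⨾ q ⨾ q′ ⨾ X ⨾ δ ⨾ ⟨⟩) ⟩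
        d * q′ + X + C * (q + δ)       ≡⟨ cong (λ z → d * q′ + X + C * z) q≡ ⟩
        d * q′ + X + C * (suc m * q′)  ≡⟨ solve (C ⨾ d ⨾ m ⨾ q′ ⨾ X ⨾ ⟨⟩) ⟩
        (d + C * suc m) * q′ + X       ≡⟨ cong (λ z → z * q′ + X) (sym y≡) ⟩
        (y + C′) * q′ + X              ≡⟨ solve (y ⨾ C′ ⨾ q′ ⨾ X ⨾ ⟨⟩) ⟩
        y * q′ + (X + C′ * q′)         ∎)
        where open ≡-Reasoning

      E′≤ : E + C * δ ≤ 3 * g * (S + C)
      E′≤ = ≤-certificate (E + C * δ) (3 * g * (S + C)) 0 (E≤ ⊕ C ⊙ δ≤ ⊕ C ⊙ δ≤3g)
        (solve (m ⨾ g ⨾ C ⨾ E ⨾ S ⨾ δ ⨾ ⟨⟩))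

      -- Each of the C wraps turns one q into m + 1 copies of q′: m are charged to S, one keeps the
      -- term C.
      total : ∀ d W C′ → y + C′ ≡ d + C * suc m → W + C′ ≤ w′ + m * (S + C) → d + W + C ≤ y + w′ + m * S
      total d W C′ y≡ ih = ≤-certificate (d + W + C) (y + w′ + m * S) 0 (ih ⊕ ≤-reflexive (sym y≡))
        (solve (m ⨾ C ⨾ S ⨾ y ⨾ w′ ⨾ d ⨾ W ⨾ C′ ⨾ ⟨⟩))

      finish : (∃ λ C′ → y + C′ ≡ digit m j + C * suc m) →
        digit m j + weight m w₀ j + C ≤ y + w′ + m * S
      finish (C′ , y≡) = total (digit m j) (weight m w₀ j) C′ y≡
        (corner-minimal j q′ C′ (E + C * δ) (S + C) N≡ N-large′ rep (eq′ (digit m j) q′ X C′ eq q≡ y≡) E′≤)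

-- Upper bound

two-coins : ∀ g .{{_ : NonZero g}} x → Rep (g ∷ 1 ∷ []) (x / g + x % g) x
two-coins g x = x / g , x % g , x % g , refl , trans (m≡m%n+[m/n]*n x g) (+-comm (x % g) _) ,
  x % g , 0 , 0 , sym (+-identityʳ _) , sym (trans (+-identityʳ _) (*-identityʳ _)) , refl

module _ {m c₀ g D t w₀ : ℕ} .{{_ : NonZero m}} .{{_ : NonZero g}}
         (t<g : t < g) (g<m : g < m) (c₀≡ : suc c₀ ≡ g * D) (w₀≡ : w₀ + 2 ≡ g + D) where

  -- A quotient below D gives at most (D - 1) + (g - 1). A quotient D forces a remainder below t,
  -- hence at most g - 2, with the same total.
  two-coins-cover : ∀ x → x < g * D + t → Rep (g ∷ 1 ∷ []) w₀ x
  two-coins-cover x x<N = rep-≤ (g ∷ 1 ∷ []) (bound (x / g) (x % g) (m%n<n x g) (subst (_< _) (m≡m%n+[m/n]*n x g) x<N)) (two-coins g x)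
    where
    bound : ∀ c d → d < g → d + c * g < g * D + t → c + d ≤ w₀
    bound c d d<g x<N with m≤n⇒m<n∨m≡n c≤D
      where
      c≤D : c ≤ D
      c≤D = ≮⇒≥ λ (D<c : D < c) → <⇒≱ z<s (≤-certificate 1 0 (1 + d) (g ⊙ D<c ⊕ x<N ⊕ t<g)
        (solve (g ⨾ D ⨾ t ⨾ c ⨾ d ⨾ ⟨⟩)))
    ... | inj₁ c<D = ≤-certificate (c + d) w₀ 0 (d<g ⊕ c<D ⊕ ≤-reflexive (sym w₀≡))
            (solve (g ⨾ D ⨾ w₀ ⨾ c ⨾ d ⨾ ⟨⟩))
    ... | inj₂ refl = ≤-certificate (c + d) w₀ 0 (x<N ⊕ t<g ⊕ ≤-reflexive (sym w₀≡))
            (solve (g ⨾ t ⨾ w₀ ⨾ c ⨾ d ⨾ ⟨⟩))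

  two-coins-cover-below : ∀ x → x < c₀ → ∃ λ w → w < w₀ × Rep (g ∷ 1 ∷ []) w x
  two-coins-cover-below x x<c₀ = _ , bound (x / g) (x % g) (m%n<n x g) (subst (_< _) (m≡m%n+[m/n]*n x g) x<c₀) , two-coins g x
    where
    bound : ∀ c d → d < g → d + c * g < c₀ → c + d < w₀
    bound c d d<g x<c₀ with m≤n⇒m<n∨m≡n c<D
      where
      c<D : c < D
      c<D = ≰⇒> λ (D≤c : D ≤ c) → <⇒≱ z<s (≤-certificate 1 0 (1 + d) (g ⊙ D≤c ⊕ x<c₀ ⊕ ≤-reflexive c₀≡)
        (solve (g ⨾ D ⨾ c₀ ⨾ c ⨾ d ⨾ ⟨⟩)))
    ... | inj₁ c+1<D = ≤-certificate (suc (c + d)) w₀ 0 (d<g ⊕ c+1<D ⊕ ≤-reflexive (sym w₀≡))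
            (solve (g ⨾ D ⨾ w₀ ⨾ c ⨾ d ⨾ ⟨⟩))
    ... | inj₂ refl = ≤-certificate (suc (c + d)) w₀ 0 (x<c₀ ⊕ ≤-reflexive c₀≡ ⊕ ≤-reflexive (sym w₀≡))
            (solve (g ⨾ c₀ ⨾ w₀ ⨾ c ⨾ d ⨾ ⟨⟩))

  split : ∀ q x → x < q → ∃ λ c → ∃ λ r → x ≡ c * shrink m q + r × r < shrink m q × c ≤ m
  split q x x<q with shrink m q | shrink-spec m q
  ... | zero   | δ , m<δ , _ , q≡ =
    ⊥-elim (<⇒≱ m<δ (≤-trans (m≤n+m δ q) (≤-trans (≤-reflexive (trans q≡ (*-zeroʳ m))) z≤n)))
  ... | suc q′ | δ , m<δ , _ , q≡ = x / suc q′ , x % suc q′ ,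
    trans (m≡m%n+[m/n]*n x (suc q′)) (+-comm (x % suc q′) _) , m%n<n x (suc q′) ,
    ≤-pred (m<n*o⇒m/o<n (<-≤-trans x<q (≤-trans (m≤m+n q δ) (≤-reflexive q≡))))

  -- A digit `m` costs one more than `pred m`. But then r < N - δ with δ > m > t, so `r < c₀`; the
  -- two lower digits are not both full and save one.
  cover-second : ∀ q x → shrink m q ≡ g * D + t → x < q → Rep (gens m g 1 q) (pred m + w₀) x
  cover-second q x N≡ x<q with split q x x<q
  ... | c , r , x≡ , r<q′ , c≤m with m≤n⇒m<n∨m≡n c≤m
  ...   | inj₁ c<m = rep-≤ (gens m g 1 q) (+-monoˡ-≤ w₀ (≤-pred (≤-trans c<m (≤-reflexive (sym (suc-pred m))))))
                       (c , _ , r , refl , x≡ , two-coins-cover r (<-≤-trans r<q′ (≤-reflexive N≡)))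
  ...   | inj₂ refl with two-coins-cover-below r (r<c₀ (shrink m q) N≡ x≡ (shrink-spec m q))
    where
    r<c₀ : ∀ N → N ≡ g * D + t → x ≡ m * N + r → (∃ λ δ → m < δ × δ ≤ 1 + 2 * m × q + δ ≡ suc m * N) → r < c₀
    r<c₀ N N≡ x≡ (δ , m<δ , _ , q≡) = ≤-certificate (suc r) c₀ 2
      (≤-trans (s≤s (≤-reflexive (sym x≡))) x<q ⊕ ≤-reflexive q≡ ⊕ ≤-reflexive N≡ ⊕ ≤-reflexive (sym c₀≡)
        ⊕ t<g ⊕ g<m ⊕ m<δ)
      (solve (m ⨾ c₀ ⨾ g ⨾ D ⨾ t ⨾ q ⨾ δ ⨾ N ⨾ r ⨾ ⟨⟩))
  ...     | w , w<w₀ , rep = rep-≤ (gens m g 1 q) total (m , w , r , refl , x≡ , rep)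
    where
    total : m + w ≤ pred m + w₀
    total = ≤-trans (≤-reflexive (trans (cong (_+ w) (sym (suc-pred m))) (sym (+-suc (pred m) w))))
      (+-monoʳ-≤ (pred m) w<w₀)

  cover-step : ∀ j w q x → (∀ r → r < shrink m q → Rep (gens m g j (shrink m q)) w r) →
    x < q → Rep (gens m g (suc j) q) (m + w) x
  cover-step j w q x cover x<q with split q x x<q
  ... | c , r , x≡ , r<q′ , c≤m =
    rep-≤ (gens m g (suc j) q) (+-monoˡ-≤ w c≤m) (c , w , r , refl , x≡ , cover r r<q′)

  gens-cover : ∀ j q x → bottom m j q ≡ g * D + t → x < q → Rep (gens m g j q) (weight m w₀ j) x
  gens-cover zero          q x N≡ x<q = two-coins-cover x (<-≤-trans x<q (≤-reflexive N≡))
  gens-cover (suc zero)    q x N≡ x<q = cover-second q x N≡ x<q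
  gens-cover (suc (suc j)) q x N≡ x<q =
    cover-step (suc j) _ q x (λ r → gens-cover (suc j) (shrink m q) r N≡) x<q

-- Size of the third generator and choice of g

-- The error 3 does not grow from level to level, since 3 + (2m + 1) < 4(m + 1).
shrink-≤ : ∀ m .{{_ : NonZero m}} P q → q ≤ suc m * P + 3 → shrink m q ≤ P + 3
shrink-≤ m P q q≤ with shrink-spec m q
... | δ , _ , δ≤ , q≡ = ≤-pred (*-cancelˡ-< (suc m) _ _ (certificate (shrink m q) (>-nonZero⁻¹ m) q≡))
  where
  certificate : ∀ q′ → 0 < m → q + δ ≡ suc m * q′ → suc m * q′ < suc m * suc (P + 3)
  certificate q′ 0<m q≡ = ≤-certificate (suc (suc m * q′)) (suc m * suc (P + 3)) 1
    (q≤ ⊕ δ≤ ⊕ ≤-reflexive (sym q≡) ⊕ 2 ⊙ 0<m) (solve (m ⨾ P ⨾ q ⨾ δ ⨾ q′ ⨾ ⟨⟩))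

bottom-≤ : ∀ m .{{_ : NonZero m}} j q → q ≤ suc m ^ (2 + j) + 3 → bottom m j q ≤ suc m * suc m + 3
bottom-≤ m zero    q q≤ = ≤-trans q≤ (≤-reflexive (cong (λ z → suc m * z + 3) (*-identityʳ (suc m))))
bottom-≤ m (suc j) q q≤ = bottom-≤ m j (shrink m q) (shrink-≤ m (suc m ^ (2 + j)) q q≤)

≤-bottom : ∀ m j q → q ≤ bottom m j q * suc m ^ j
≤-bottom m zero    q = ≤-reflexive (sym (*-identityʳ q))
≤-bottom m (suc j) q with shrink-spec m q
... | δ , _ , _ , q≡ = begin
  q                                               ≤⟨ m≤m+n q δ ⟩
  q + δ                                           ≡⟨ q≡ ⟩
  suc m * shrink m q                              ≤⟨ suc m ⊙ ≤-bottom m j (shrink m q) ⟩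
  suc m * (bottom m j (shrink m q) * suc m ^ j)   ≡⟨ *-swap (suc m) (bottom m j (shrink m q)) (suc m ^ j) ⟩
  bottom m j (shrink m q) * (suc m * suc m ^ j)   ∎
  where
  open ≤-Reasoning

-- This is (1 + 1/m)^j (1 - j/m) ≤ 1 without division, with `r` = m - j. One step is (m + 1)r ≤ m(r
-- + 1), that is, r ≤ m.
bernoulli : ∀ m j r → j + r ≡ m → suc m ^ j * r ≤ m ^ suc j
bernoulli m zero    r refl = ≤-reflexive (*-comm 1 r)
bernoulli m (suc j) r 1+j+r≡m =
  certificate (suc m ^ j) (m ^ suc j) (bernoulli m j (suc r) (trans (+-suc j r) 1+j+r≡m)) r≤m
  where
  r≤m : r ≤ m
  r≤m = ≤-trans (m≤n+m r (suc j)) (≤-reflexive 1+j+r≡m)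
  certificate : ∀ a b → a * suc r ≤ b → r ≤ m → suc m * a * r ≤ m * b
  certificate a b ih r≤m = ≤-certificate (suc m * a * r) (m * b) 0 (m ⊙ ih ⊕ a ⊙ r≤m) (solve (m ⨾ r ⨾ a ⨾ b ⨾ ⟨⟩))

-- Rounding only raises the generators, so N(m + 1)^j ≥ q ≥ m^(j + 2). With `bottom-≤` this pins N
-- to m² up to a multiple of m depending on `j`.
m*r≤bottom : ∀ m j r q → j + r ≡ m → m ^ (2 + j) ≤ q → m * r ≤ bottom m j q
m*r≤bottom m j r q j+r≡m m^k≤q = *-cancelˡ-≤ (suc m ^ j) {{m^n≢0 (suc m) j}} (begin
  suc m ^ j * (m * r)         ≡⟨ *-swap (suc m ^ j) m r ⟩
  m * (suc m ^ j * r)         ≤⟨ m ⊙ bernoulli m j r j+r≡m ⟩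
  m ^ (2 + j)                 ≤⟨ m^k≤q ⟩
  q                           ≤⟨ ≤-bottom m j q ⟩
  bottom m j q * suc m ^ j    ≡⟨ *-comm (bottom m j q) _ ⟩
  suc m ^ j * bottom m j q    ∎)
  where
  open ≤-Reasoning

-- Going left from `d`, the value rises by at most one per step and cannot jump over `T`.
discrete-ivt : ∀ (f : ℕ → ℕ) T d → f d ≤ T → T ≤ f 0 → (∀ i → f i ≤ suc (f (suc i))) →
  ∃ λ i → i ≤ d × f i ≡ T
discrete-ivt f T zero    fd≤T T≤f0 step = 0 , z≤n , ≤-antisym fd≤T T≤f0
discrete-ivt f T (suc d) fd≤T T≤f0 step with m≤n⇒m<n∨m≡n fd≤T
... | inj₂ fd≡T = suc d , ≤-refl , fd≡T
... | inj₁ fd<T with discrete-ivt f T d (≤-trans (step d) fd<T) T≤f0 step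
...   | i , i≤d , fi≡T = i , m≤n⇒m≤1+n i≤d , fi≡T

m*n≤o⇒m≤o/n : ∀ {m n o} .{{_ : NonZero n}} → m * n ≤ o → m ≤ o / n
m*n≤o⇒m≤o/n {m} {n} m*n≤o = ≤-trans (≤-reflexive (sym (m*n/n≡m m n))) (/-monoˡ-≤ n m*n≤o)

Choice : (m n N T : ℕ) → Set
Choice m n N T = ∃ λ g → ∃ λ D → ∃ λ t → m ≤ g + n × 2 + g ≤ m × N ≡ g * D + t × t < g × g + D ≡ T

-- The largest choice g = m − 2 gives a sum at most 2m + 2. Moving g down to m − n makes the sum
-- exceed 2m by about n²/m, and each unit step raises it by at most one since N ≤ 2g(g − 1).
module _ {m n N j r s : ℕ} (4n≤m : 4 * n ≤ m) (m≤4n+3 : m ≤ 4 * n + 3) (10[3+j]≤n : 10 * (3 + j) ≤ n)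
         (10s≤n : 10 * s ≤ n) (j+r≡m : j + r ≡ m) (mr≤N : m * r ≤ N) (N≤ : N ≤ suc m * suc m + 3) where

  30≤n : 30 ≤ n
  30≤n = ≤-trans (10 ⊙ m≤m+n 3 j) 10[3+j]≤n

  sum-at-top : ∀ h .{{_ : NonZero h}} → 2 + h ≡ m → h + N / h ≤ 2 * m + 2
  sum-at-top h refl = ≤-certificate (h + N / h) (2 * (2 + h) + 2) 0 quotient (identity (N / h))
    where
    identity : ∀ d → h + d + (h + 7) + 0 ≡ 2 * (2 + h) + 2 + suc d
    identity d = solve (h ⨾ d ⨾ ⟨⟩)
    13≤h : 13 ≤ h
    13≤h = ≤-certificate 13 h 105 (4n≤m ⊕ 4 ⊙ 30≤n) (solve (n ⨾ h ⨾ ⟨⟩))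
    -- N ≤ (h + 3)² + 3 = h² + 6h + 12, below h(h + 7) once h ≥ 13; and h + (h + 6) = 2m + 2.
    quotient : N / h < h + 7
    quotient = m<n*o⇒m/o<n (≤-certificate (suc N) ((h + 7) * h) 0 (N≤ ⊕ 13≤h) (solve (N ⨾ h ⨾ ⟨⟩)))

  sum-at-bottom : ∀ h .{{_ : NonZero h}} → h + n ≡ m → 2 * m + 3 + s ≤ h + N / h
  sum-at-bottom h h+n≡m = ≤-certificate (2 * m + 3 + s) (h + N / h) 0
    (m*n≤o⇒m≤o/n {m + n + 3 + s} product ⊕ ≤-reflexive (sym h+n≡m)) (identity (N / h))
    where
    identity : ∀ d → 2 * m + 3 + s + (d + (h + n)) + 0 ≡ h + d + (m + n + 3 + s + m)
    identity d = solve (m ⨾ n ⨾ s ⨾ h ⨾ d ⨾ ⟨⟩)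
    h≤m : h ≤ m
    h≤m = ≤-trans (m≤m+n h n) (≤-reflexive h+n≡m)
    m≤5n : m ≤ 5 * n
    m≤5n = ≤-certificate m (5 * n) 27 (m≤4n+3 ⊕ 30≤n) (solve (m ⨾ n ⨾ ⟨⟩))
    5[3+s+j]≤n : 5 * (3 + s + j) ≤ n
    5[3+s+j]≤n = *-cancelˡ-≤ 2 (≤-certificate (2 * (5 * (3 + s + j))) (2 * n) 0 (10[3+j]≤n ⊕ 10s≤n)
      (solve (n ⨾ s ⨾ j ⨾ ⟨⟩)))
    square : (3 + s + j) * m ≤ n * n
    square = ≤-certificate ((3 + s + j) * m) (n * n) 0 ((3 + s + j) ⊙ m≤5n ⊕ n ⊙ 5[3+s+j]≤n)
      (solve (m ⨾ n ⨾ s ⨾ j ⨾ ⟨⟩))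
    -- (m + n)(m - n) = m² - n², and n² ≥ (3 + s + j)m pays for (3 + s)h and for the loss jm in N.
    product : (m + n + 3 + s) * h ≤ N
    product = ≤-certificate ((m + n + 3 + s) * h) N 0
      (m ⊙ ≤-reflexive h+n≡m ⊕ n ⊙ ≤-reflexive h+n≡m ⊕ (3 + s) ⊙ h≤m ⊕ square ⊕ m ⊙ ≤-reflexive (sym j+r≡m) ⊕ mr≤N)
      (solve (m ⨾ n ⨾ N ⨾ j ⨾ r ⨾ s ⨾ h ⨾ ⟨⟩))

  sum-step : ∀ h .{{_ : NonZero h}} → m ≤ h + n → h + N / h ≤ suc (suc h + N / suc h)
  sum-step h m≤h+n = ≤-certificate (h + N / h) (suc (suc h + N / suc h)) 0 quotient (identity (N / h) (N / suc h))
    where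
    identity : ∀ d d′ → h + d + (d′ + 3) + 0 ≡ suc (suc h + d′) + suc d
    identity d d′ = solve (h ⨾ d ⨾ d′ ⨾ ⟨⟩)
    3n≤h : 3 * n ≤ h
    3n≤h = ≤-certificate (3 * n) h 0 (4n≤m ⊕ m≤h+n) (solve (m ⨾ n ⨾ h ⨾ ⟨⟩))
    sm≤ : suc m ≤ 4 * n + 4
    sm≤ = ≤-certificate (suc m) (4 * n + 4) 0 m≤4n+3 (solve (m ⨾ n ⨾ ⟨⟩))
    sm²≤ : suc m * suc m ≤ (4 * n + 4) * (4 * n + 4)
    sm²≤ = *-mono-≤ sm≤ sm≤
    h²≥ : 3 * n * suc (3 * n) ≤ h * suc h
    h²≥ = *-mono-≤ 3n≤h (s≤s 3n≤h)
    -- As h ≥ 3n, the right side is at least 18n², against about 16n² for N; the surplus 2n² ≥ 60n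
    -- absorbs the lower terms.
    N< : N < 2 * h * suc h
    N< = ≤-certificate (suc N) (2 * h * suc h) (33 * n + 10)
      (N≤ ⊕ sm²≤ ⊕ 2 ⊙ h²≥ ⊕ 2 ⊙ n ⊙ 30≤n ⊕ 30≤n) (solve (m ⨾ n ⨾ N ⨾ h ⨾ ⟨⟩))
    d′< : N / suc h < 2 * h
    d′< = m<n*o⇒m/o<n N<
    -- Passing from h + 1 to h leaves x + d < 3h to redistribute, so the quotient grows by at most
    -- 2.
    certificate : ∀ x d → N ≡ x + d * suc h → x < suc h → d < 2 * h → N < (d + 3) * h
    certificate x d N≡ x< d< = ≤-certificate (suc N) ((d + 3) * h) 0 (≤-reflexive N≡ ⊕ x< ⊕ d<)
      (solve (N ⨾ h ⨾ x ⨾ d ⨾ ⟨⟩))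
    quotient : N / h < N / suc h + 3
    quotient = m<n*o⇒m/o<n (certificate (N % suc h) (N / suc h) (m≡m%n+[m/n]*n N (suc h)) (m%n<n N (suc h)) d′<)

  n<m : n < m
  n<m = ≤-certificate (suc n) m (2 * n + 29) (4n≤m ⊕ 30≤n) (solve (m ⨾ n ⨾ ⟨⟩))

  choose-g : ∀ T → 2 * m + 2 ≤ T → T ≤ 2 * m + 3 + s → Choice m n N T
  choose-g T T≥ T≤ = search (m≤n⇒∃[o]m+o≡n (≤-trans (m≤m+n 2 28) 30≤n)) (m≤n⇒∃[o]m+o≡n n<m)
    where
    search : (∃ λ d → 2 + d ≡ n) → (∃ λ a → suc n + a ≡ m) → Choice m n N T
    search (d , 2+d≡n) (a , 1+n+a≡m) = found (discrete-ivt sumOf T d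
        (≤-trans (sum-at-top (suc d + a) 2+h≡m) T≥) (≤-trans T≤ (sum-at-bottom (suc a) h+n≡m))
        (λ i → sum-step (suc i + a) (m≤h+n i)))
      where
      -- `suc i + a` runs from m - n at i = 0 to m - 2 at i = `d`.
      sumOf : ℕ → ℕ
      sumOf i = suc i + a + N / (suc i + a)
      2+h≡m : 2 + (suc d + a) ≡ m
      2+h≡m = trans (cong (λ z → suc (z + a)) 2+d≡n) 1+n+a≡m
      h+n≡m : suc a + n ≡ m
      h+n≡m = trans (cong suc (+-comm a n)) 1+n+a≡m
      m≤h+n : ∀ i → m ≤ suc i + a + n
      m≤h+n i = ≤-trans (≤-reflexive (sym h+n≡m)) (s≤s (+-monoˡ-≤ n (m≤n+m a i)))
      found : (∃ λ i → i ≤ d × sumOf i ≡ T) → Choice m n N T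
      found (i , i≤d , sum≡T) = g , N / g , N % g , m≤h+n i ,
        ≤-trans (s≤s (s≤s (s≤s (+-monoˡ-≤ a i≤d)))) (≤-reflexive 2+h≡m) ,
        trans (m≡m%n+[m/n]*n N g) (trans (+-comm (N % g) _) (cong (_+ N % g) (*-comm (N / g) g))) ,
        m%n<n N g , sum≡T
        where
        g = suc i + a

-- Exact order and the constants

excess : ℕ → ℕ
excess zero    = 0
excess (suc _) = 1

excess≤1 : ∀ j → excess j ≤ 1
excess≤1 zero    = z≤n
excess≤1 (suc j) = ≤-refl

-- For `j` ≥ 1 the digit m - 1 of a_3 leaves the upper digits one short of jm; `excess` returns that
-- unit through the two lowest digits.
weight≡ : ∀ m .{{_ : NonZero m}} s j → weight m (2 * m + s + excess j) j ≡ (2 + j) * m + s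
weight≡ m       s zero          = +-identityʳ (2 * m + s)
weight≡ (suc μ) s (suc zero)    = identity μ s
  where
  identity : ∀ μ s → μ + (2 * suc μ + s + 1) ≡ 3 * suc μ + s
  identity = solve-∀
weight≡ m       s (suc (suc j)) = trans (cong (m +_) (weight≡ m s (suc j))) (sym (+-assoc m ((3 + j) * m) s))

exact-order : ∀ {m g D t j p s} .{{_ : NonZero m}} → 3 ≤ g → g ≤ D → g < m → 1 + 2 * m ≤ 3 * g →
  bottom m j p ≡ g * D + t → t < g → (1 + 2 * m) * j ≤ bottom m j p → g + D ≡ 2 * m + s + excess j + 2 →
  NonzeroSet p (2 + j) (gens m g j p) × IsBasisOfOrder p (WithZero (gens m g j p)) ((2 + j) * m + s)
exact-order {m} {g} {D} {t} {j} {p} {s} 3≤g g≤D g<m 1+2m≤3g N≡ t<g N-large g+D≡ =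
  gens-nonzeroSet (≤-trans 2≤g (<⇒≤ g<m)) j p 2≤g g<N (≤-trans 3≤g (<⇒≤ g<N)) , covers , notCovers
  where
  A : Vec ℕ (2 + j)
  A = gens m g j p
  h c₀ w₀ : ℕ
  h  = (2 + j) * m + s
  c₀ = pred (g * D)
  w₀ = 2 * m + s + excess j
  2≤g : 2 ≤ g
  2≤g = ≤-trans (m≤m+n 2 1) 3≤g
  instance
    g≢0 : NonZero g
    g≢0 = >-nonZero (<-trans z<s 2≤g)
    gD≢0 : NonZero (g * D)
    gD≢0 = m*n≢0 g D {{g≢0}} {{>-nonZero (<-≤-trans (<-trans z<s 2≤g) g≤D)}}
  c₀≡ : suc c₀ ≡ g * D
  c₀≡ = suc-pred (g * D)
  gD≤N : g * D ≤ bottom m j p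
  gD≤N = ≤-trans (m≤m+n (g * D) t) (≤-reflexive (sym N≡))
  g<N : g < bottom m j p
  g<N = ≤-trans (m<m*n g D (≤-trans 2≤g g≤D)) gD≤N
  weight≡h : weight m w₀ j ≡ h
  weight≡h = weight≡ m s j
  0<h : 0 < h
  0<h = ≤-trans (>-nonZero⁻¹ m) (≤-trans (m≤m+n m _) (m≤m+n _ s))

  covers : Covers p (WithZero A) h
  covers x x<p with rep⇒sum A (gens-cover t<g g<m c₀≡ (sym g+D≡) j p x N≡ x<p)
  ... | v , ps , sum≡ = subst (λ z → InSumset p (WithZero A) z x) weight≡h (v , ps , 0 , trans sum≡ (sym (+-identityʳ x)))

  notCovers : ¬ Covers p (WithZero A) (h ∸ 1)
  -- The corner is the missed residue. The `q` multiples of `p` enter `corner-minimal` as `C`, with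
  -- no deficit and no wraps above.
  notCovers cover with cover (corner m c₀ j p) (corner< j p (≤-trans (≤-reflexive c₀≡) gD≤N) N-large)
  ... | v , ps , q , sum≡ = <⇒≱ (∸-monoʳ-< {h} z<s 0<h) (begin
    h                     ≡⟨ sym weight≡h ⟩
    weight m w₀ j         ≤⟨ m≤m+n _ q ⟩
    weight m w₀ j + q     ≤⟨ corner-minimal 3≤g g≤D g<m 1+2m≤3g c₀≡ (sym g+D≡) j p q 0 0 N≡ N-large
                               (sum⇒rep A v ps) (trans (+-identityʳ _) sum≡) z≤n ⟩
    h ∸ 1 + m * 0         ≡⟨ cong (h ∸ 1 +_) (*-zeroʳ m) ⟩
    h ∸ 1 + 0             ≡⟨ +-identityʳ (h ∸ 1) ⟩
    h ∸ 1                 ∎)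
    where open ≤-Reasoning

basis-of-order : ∀ {m n p j r s} → 4 * n ≤ m → m ≤ 4 * n + 3 → 10 * (3 + j) ≤ n → 10 * s ≤ n → j + r ≡ m →
  m ^ (2 + j) ≤ p → p < suc m ^ (2 + j) →
  Σ (Vec ℕ (2 + j)) λ A → NonzeroSet p (2 + j) A × IsBasisOfOrder p (WithZero A) ((2 + j) * m + s)
basis-of-order {m} {n} {p} {j} {r} {s} 4n≤m m≤4n+3 10[3+j]≤n 10s≤n j+r≡m m^k≤p p< =
  finish (choose-g {s = s} 4n≤m m≤4n+3 10[3+j]≤n 10s≤n j+r≡m mr≤N N≤ T T≥ T≤)
  where
  N T : ℕ
  N = bottom m j p
  T = 2 * m + s + excess j + 2
  1≤n : 1 ≤ n
  1≤n = ≤-trans (m≤m+n 1 _) (≤-trans (10 ⊙ m≤m+n 3 j) 10[3+j]≤n)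
  1≤m : 1 ≤ m
  1≤m = ≤-trans 1≤n (≤-trans (m≤m+n n _) 4n≤m)
  instance
    m≢0 : NonZero m
    m≢0 = >-nonZero 1≤m
  mr≤N : m * r ≤ N
  mr≤N = m*r≤bottom m j r p j+r≡m m^k≤p
  N≤ : N ≤ suc m * suc m + 3
  N≤ = bottom-≤ m j p (≤-trans (<⇒≤ p<) (m≤m+n _ 3))
  T≥ : 2 * m + 2 ≤ T
  T≥ = +-monoˡ-≤ 2 (≤-trans (m≤m+n (2 * m) s) (m≤m+n (2 * m + s) (excess j)))
  T≤ : T ≤ 2 * m + 3 + s
  T≤ = certificate (excess j) (excess≤1 j)
    where
    certificate : ∀ e → e ≤ 1 → 2 * m + s + e + 2 ≤ 2 * m + 3 + s
    certificate e e≤1 = ≤-certificate (2 * m + s + e + 2) (2 * m + 3 + s) 0 e≤1 (solve (m ⨾ s ⨾ e ⨾ ⟨⟩))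
  3j≤r : 3 * j ≤ r
  3j≤r = ≤-certificate (3 * j) r (36 * j + 120) (≤-reflexive (sym j+r≡m) ⊕ 4n≤m ⊕ 4 ⊙ 10[3+j]≤n)
    (solve (m ⨾ n ⨾ j ⨾ r ⨾ ⟨⟩))
  N-large : (1 + 2 * m) * j ≤ N
  N-large = ≤-trans (≤-certificate ((1 + 2 * m) * j) (m * r) 0 (m ⊙ 3j≤r ⊕ j ⊙ 1≤m) (solve (m ⨾ j ⨾ r ⨾ ⟨⟩))) mr≤N

  finish : Choice m n N T →
    Σ (Vec ℕ (2 + j)) λ A → NonzeroSet p (2 + j) A × IsBasisOfOrder p (WithZero A) ((2 + j) * m + s)
  finish (g , D , t , m≤g+n , 2+g≤m , N≡ , t<g , g+D≡) =
    gens m g j p , exact-order 3≤g g≤D (≤-trans (n≤1+n _) 2+g≤m) 1+2m≤3g N≡ t<g N-large g+D≡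
    where
    3≤g : 3 ≤ g
    3≤g = ≤-certificate 3 g 0 (m≤g+n ⊕ 4n≤m ⊕ 3 ⊙ 1≤n) (solve (m ⨾ n ⨾ g ⨾ ⟨⟩))
    g≤D : g ≤ D
    g≤D = ≤-certificate g D 6 (≤-trans T≥ (≤-reflexive (sym g+D≡)) ⊕ 2 ⊙ 2+g≤m) (solve (m ⨾ g ⨾ D ⨾ ⟨⟩))
    -- From g ≥ m - n and m ≥ 4n: 3g ≥ 2m + n.
    1+2m≤3g : 1 + 2 * m ≤ 3 * g
    1+2m≤3g = ≤-certificate (1 + 2 * m) (3 * g) 0 (3 ⊙ m≤g+n ⊕ 4n≤m ⊕ 1≤n) (solve (m ⨾ n ⨾ g ⨾ ⟨⟩))

theorem4p4 : Σ ℕ λ a → Σ ℕ λ b → (0 < a) × (0 < b) ×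
    ((k : ℕ) → 2 ≤ k → Σ ℕ λ P → (p : ℕ) → Prime p → P ≤ p →
    (m : ℕ) → IsFloorRoot k p m → (s : ℕ) → s * b < a * m →
    Σ (Vec ℕ k) λ A → NonzeroSet p k A × IsBasisOfOrder p (WithZero A) (k * m + s))
-- c = 1/50. With n = ⌊m/4⌋ the construction needs 10s ≤ n, and 50s < m ≤ 4n + 3 gives 50s ≤ 5n
-- because n ≥ 2.
theorem4p4 = 1 , 50 , z<s , z<s , bases
  where
  bases : (k : ℕ) → 2 ≤ k → Σ ℕ λ P → (p : ℕ) → Prime p → P ≤ p →
    (m : ℕ) → IsFloorRoot k p m → (s : ℕ) → s * 50 < 1 * m →
    Σ (Vec ℕ k) λ A → NonzeroSet p k A × IsBasisOfOrder p (WithZero A) (k * m + s)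
  bases (suc (suc j)) (s≤s (s≤s z≤n)) = M ^ (2 + j) , λ p _ M^k≤p m (m^k≤p , p<) s s<cm →
    large p m s (≮⇒≥ λ m<M → <⇒≱ p< (≤-trans (^-monoˡ-≤ (2 + j) m<M) M^k≤p)) m^k≤p p< s<cm
    where
    -- m ≥ `M` means 10(3 + j) ≤ ⌊m/4⌋, and p ≥ M^k forces m ≥ `M` because p < (m + 1)^k.
    M : ℕ
    M = 10 * (3 + j) * 4
    large : ∀ p m s → M ≤ m → m ^ (2 + j) ≤ p → p < suc m ^ (2 + j) → s * 50 < 1 * m →
      Σ (Vec ℕ (2 + j)) λ A → NonzeroSet p (2 + j) A × IsBasisOfOrder p (WithZero A) ((2 + j) * m + s)
    large p m s M≤m m^k≤p p< s<cm =
      basis-of-order 4n≤m (m≤ (m / 4) (m % 4) (m≡m%n+[m/n]*n m 4) (m%n<n m 4)) 10[3+j]≤n 10s≤n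
        (proj₂ (m≤n⇒∃[o]m+o≡n j≤m)) m^k≤p p<
      where
      n : ℕ
      n = m / 4
      10[3+j]≤n : 10 * (3 + j) ≤ n
      10[3+j]≤n = m*n≤o⇒m≤o/n M≤m
      4n≤m : 4 * n ≤ m
      4n≤m = ≤-trans (≤-reflexive (*-comm 4 n)) (m/n*n≤m m 4)
      m≤ : ∀ n x → m ≡ x + n * 4 → x < 4 → m ≤ 4 * n + 3
      m≤ n x m≡ x<4 = ≤-certificate m (4 * n + 3) 0 (≤-reflexive m≡ ⊕ x<4) (solve (m ⨾ n ⨾ x ⨾ ⟨⟩))
      j≤m : j ≤ m
      j≤m = ≤-trans (m≤n+m j 3) (≤-trans (m≤n*m (3 + j) 10) (≤-trans (m≤m*n (10 * (3 + j)) 4) M≤m))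
      10s≤n : 10 * s ≤ n
      10s≤n = *-cancelˡ-≤ 5 (certificate n (m≤ n (m % 4) (m≡m%n+[m/n]*n m 4) (m%n<n m 4))
        (≤-trans (m≤m+n 2 28) (≤-trans (10 ⊙ m≤m+n 3 j) 10[3+j]≤n)))
        where
        certificate : ∀ n → m ≤ 4 * n + 3 → 2 ≤ n → 5 * (10 * s) ≤ 5 * n
        certificate n m≤ 2≤n = ≤-certificate (5 * (10 * s)) (5 * n) 0 (s<cm ⊕ m≤ ⊕ 2≤n) (solve (m ⨾ n ⨾ s ⨾ ⟨⟩))
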